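{- Let $G$ and $H$ be finite graphs. Then \[ n(G)\,\gamma(H)-m(G)\;\le\; \gamma_{\rm S}(G,H)\;\le\; \Gamma_{\rm S}(G,H)\;\le\; n(G)\,\gamma(H), \] where $n(G)=|V(G)|$ and $m(G)=|E(G)|$.
   Context: All graphs are finite and simple; $\gamma(X)$ denotes the domination number of a graph $X$ (the minimum size of a set $S$ of vertices such that every vertex is in $S$ or adjacent to a vertex of $S$). For graphs $G,H$ and a function $f\colon V(G)\to V(H)$, the Sierpiński product $G\otimes_f H$ is the graph with vertex set $V(G)\times V(H)$ and edges of two types: (type 1) $(g,h)(g,h')$ for every $g\in V(G)$ and every edge $hh'\in E(H)$; (type 2) $(g,f(g'))(g',f(g))$ for every edge $gg'\in E(G)$. The Sierpiński domination number is $\gamma_{\rm S}(G,H)=\min_{f}\gamma(G\otimes_f H)$ and the upper Sierpiński domination number is $\Gamma_{\rm S}(G,H)=\max_{f}\gamma(G\otimes_f H)$, where $f$ ranges over all functions $V(G)\to V(H)$. -}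

module Defs where

open import Data.Fin.Base using (Fin; finToFun; funToFin)
open import Data.Fin.Properties using (any?; all?; *↔×; finToFun-funToFin)
  renaming (_≟_ to _≟ᶠ_; _<?_ to _<ᶠ?_)
open import Data.Fin.Subset using (Subset; ⊤; ∣_∣; _∈_)
open import Data.Fin.Subset.Properties using (_∈?_; anySubset?; ∈⊤; ∣p∣≤n)
open import Data.List.Base using (List; length; filter; allFin; cartesianProduct)
open import Data.Nat.Base using (ℕ; zero; suc; _*_; _^_; _≤_; _<_; z≤n)
open import Data.Nat.Properties
  using (_≟_; ≤-antisym; ≤-pred; ≤∧≢⇒<; ≮⇒≥; anyUpTo?)
open import Data.Nat.Induction using (<-rec)
open import Data.Product.Base using (∃; _×_; _,_; proj₁; proj₂)
open import Data.Product.Function.NonDependent.Propositional using (_×-↔_)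
open import Data.Sum.Base using (_⊎_; inj₁; inj₂)
open import Data.Unit.Base using (tt)
open import Function.Base using (_∘_)
open import Function.Bundles using (_↔_; Inverse)
open import Function.Properties.Inverse using (↔-sym; ↔-trans)
open import Relation.Binary.Definitions using (Symmetric; Irreflexive; DecidableEquality)
  renaming (Decidable to Decidable₂)
open import Relation.Binary.PropositionalEquality
  using (_≡_; _≗_; refl; sym; trans; cong; subst)
open import Relation.Nullary.Decidable using (Dec; yes; no; map′; _×-dec_; _⊎-dec_)
open import Relation.Nullary.Negation using (¬_; contradiction)
open import Relation.Unary using (Pred; Decidable)
open import Level using (0ℓ)

IsLeast : Pred ℕ 0ℓ → ℕ → Set
IsLeast P k = P k × (∀ j → P j → k ≤ j)

IsGreatest : Pred ℕ 0ℓ → ℕ → Set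
IsGreatest P k = P k × (∀ j → P j → j ≤ k)

least : {P : Pred ℕ 0ℓ} → Decidable P → ∃ P → ∃ (IsLeast P)
least {P} P? (k , pk) = <-rec (λ k → P k → ∃ (IsLeast P)) step k pk
  where
  step : ∀ k → (∀ {j} → j < k → P j → ∃ (IsLeast P)) → P k → ∃ (IsLeast P)
  step k rec pk with anyUpTo? P? k
  ... | yes (j , j<k , pj) = rec j<k pj
  ... | no  none           = k , pk , λ j pj → ≮⇒≥ (λ j<k → none (j , j<k , pj))

greatest : {P : Pred ℕ 0ℓ} → Decidable P → ∃ P →
           ∀ b → (∀ j → P j → j ≤ b) → ∃ (IsGreatest P)
greatest P? ∃P b bound with P? b
... | yes pb = b , pb , bound
greatest P? (j , pj) zero    bound | no ¬pb with bound j pj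
... | z≤n = contradiction pj ¬pb
greatest {P} P? ∃P   (suc b) bound | no ¬pb = greatest P? ∃P b λ j pj →
  ≤-pred (≤∧≢⇒< (bound j pj) (λ j≡b → ¬pb (subst P j≡b pj)))

record Graph : Set₁ where
  field
    V      : Set
    order  : ℕ
    finite : V ↔ Fin order
    Adj    : V → V → Set
    adj?   : Decidable₂ Adj
    adj-sym    : Symmetric Adj
    adj-irrefl : Irreflexive _≡_ Adj

  open Inverse finite public
    using () renaming (to to index; from to vertex;
                       strictlyInverseʳ to vertex-index)

  _≟ᵛ_ : DecidableEquality V
  u ≟ᵛ v = map′
    (λ e → trans (sym (vertex-index u)) (trans (cong vertex e) (vertex-index v)))
    (cong index)
    (index u ≟ᶠ index v)

  anyVertex? : {P : Pred V 0ℓ} → Decidable P → Dec (∃ P)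
  anyVertex? {P} P? = map′
    (λ (i , p) → vertex i , p)
    (λ (v , p) → index v , subst P (sym (vertex-index v)) p)
    (any? (P? ∘ vertex))

  allVertices? : {P : Pred V 0ℓ} → Decidable P → Dec (∀ v → P v)
  allVertices? {P} P? = map′
    (λ p v → subst P (vertex-index v) (p (index v)))
    (λ p i → p (vertex i))
    (all? (P? ∘ vertex))

open Graph using (V)

n : Graph → ℕ
n = Graph.order

-- Each edge {u , v} is listed once, as its pair of indices in increasing order.

edges : (G : Graph) → List (Fin (n G) × Fin (n G))
edges G = filter
  (λ (i , j) → (i <ᶠ? j) ×-dec adj? (vertex i) (vertex j))
  (cartesianProduct (allFin (n G)) (allFin (n G)))
  where open Graph G

m : Graph → ℕ
m G = length (edges G)

-- A set of vertices is given by the set of its indices.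

Dominating : (G : Graph) → Subset (n G) → Set
Dominating G S = ∀ v → (index v ∈ S) ⊎ (∃ λ u → index u ∈ S × Adj v u)
  where open Graph G

dominating? : (G : Graph) → Decidable (Dominating G)
dominating? G S = allVertices? λ v →
  (index v ∈? S) ⊎-dec anyVertex? (λ u → (index u ∈? S) ×-dec adj? v u)
  where open Graph G

DominatingSize : Graph → Pred ℕ 0ℓ
DominatingSize G k = ∃ λ (S : Subset (n G)) → Dominating G S × ∣ S ∣ ≡ k

least-dominating : (G : Graph) → ∃ (IsLeast (DominatingSize G))
least-dominating G = least
  (λ k → anySubset? (λ S → dominating? G S ×-dec (∣ S ∣ ≟ k)))
  (∣ ⊤ {n G} ∣ , ⊤ , (λ _ → inj₁ ∈⊤) , refl)

γ : Graph → ℕ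
γ G = proj₁ (least-dominating G)

γ≤n : ∀ G → γ G ≤ n G
γ≤n G with least-dominating G
... | _ , (S , _ , refl) , _ = ∣p∣≤n S

SierpińskiAdj : (G H : Graph) → (V G → V H) → V G × V H → V G × V H → Set
SierpińskiAdj G H f (g , h) (g′ , h′) =
  (g ≡ g′ × Graph.Adj H h h′) ⊎ (Graph.Adj G g g′ × h ≡ f g′ × h′ ≡ f g)

Sierpiński : (G H : Graph) → (V G → V H) → Graph
Sierpiński G H f = record
  { V          = V G × V H
  ; order      = n G * n H
  ; finite     = ↔-trans (G.finite ×-↔ H.finite) (↔-sym *↔×)
  ; Adj        = SierpińskiAdj G H f
  ; adj?       = λ (g , h) (g′ , h′) →
                   ((g G.≟ᵛ g′) ×-dec H.adj? h h′) ⊎-dec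
                   (G.adj? g g′ ×-dec (h H.≟ᵛ f g′) ×-dec (h′ H.≟ᵛ f g))
  ; adj-sym    = λ where
      (inj₁ (e , a))     → inj₁ (sym e , H.adj-sym a)
      (inj₂ (a , p , q)) → inj₂ (G.adj-sym a , q , p)
  ; adj-irrefl = λ where
      refl (inj₁ (_ , a)) → H.adj-irrefl refl a
      refl (inj₂ (a , _)) → G.adj-irrefl refl a
  }
  where
  module G = Graph G
  module H = Graph H

infix 8 Sierpiński
syntax Sierpiński G H f = G ⊗[ f ] H

SierpińskiValue : (G H : Graph) → Pred ℕ 0ℓ
SierpińskiValue G H k = ∃ λ (f : V G → V H) → γ (G ⊗[ f ] H) ≡ k

γ-cong : ∀ G H {f f′ : V G → V H} → f ≗ f′ → γ (G ⊗[ f ] H) ≡ γ (G ⊗[ f′ ] H)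
γ-cong G H f≗f′ = ≤-antisym (γ-mono (sym ∘ f≗f′)) (γ-mono f≗f′)
  where
  dominating-resp : ∀ {f f′ : V G → V H} → f ≗ f′ → ∀ {S} →
                    Dominating (G ⊗[ f ] H) S → Dominating (G ⊗[ f′ ] H) S
  dominating-resp e dom v with dom v
  ... | inj₁ v∈S                            = inj₁ v∈S
  ... | inj₂ (u , u∈S , inj₁ a)             = inj₂ (u , u∈S , inj₁ a)
  ... | inj₂ (u , u∈S , inj₂ (a , p , q))   =
    inj₂ (u , u∈S , inj₂ (a , trans p (e _) , trans q (e _)))

  γ-mono : ∀ {f f′ : V G → V H} → f ≗ f′ → γ (G ⊗[ f′ ] H) ≤ γ (G ⊗[ f ] H)
  γ-mono {f} {f′} e with least-dominating (G ⊗[ f ] H) | least-dominating (G ⊗[ f′ ] H)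
  ... | k , (S , dom , size) , _ | _ , _ , k′≤ = k′≤ k (S , dominating-resp e dom , size)

module _ (G H : Graph) where
  private
    module G = Graph G
    module H = Graph H

  decode : Fin (n H ^ n G) → V G → V H
  decode c = H.vertex ∘ finToFun c ∘ G.index

  encode : (V G → V H) → Fin (n H ^ n G)
  encode f = funToFin (H.index ∘ f ∘ G.vertex)

  decode-encode : ∀ f → decode (encode f) ≗ f
  decode-encode f g =
    trans (cong H.vertex (finToFun-funToFin (H.index ∘ f ∘ G.vertex) (G.index g)))
          (trans (H.vertex-index _) (cong f (G.vertex-index g)))

  function? : Dec (V G → V H)
  function? = map′ (decode ∘ proj₁) (λ f → encode f , tt) (any? (λ _ → yes tt))

  sierpińskiValue? : Decidable (SierpińskiValue G H)
  sierpińskiValue? k = map′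
    (λ (c , e) → decode c , e)
    (λ (f , e) → encode f , trans (γ-cong G H (decode-encode f)) e)
    (any? (λ c → γ (G ⊗[ decode c ] H) ≟ k))

  least-sierpiński : (V G → V H) → ∃ (IsLeast (SierpińskiValue G H))
  least-sierpiński f = least sierpińskiValue? (_ , f , refl)

  greatest-sierpiński : (V G → V H) → ∃ (IsGreatest (SierpińskiValue G H))
  greatest-sierpiński f = greatest sierpińskiValue? (_ , f , refl) (n G * n H)
    λ { _ (f′ , refl) → γ≤n (G ⊗[ f′ ] H) }

  -- If there is no function V G → V H (H has no vertices but G has some), the
  -- minimum and the maximum are over the empty set and are taken to be 0.

  γS : ℕ
  γS with function?
  ... | yes f = proj₁ (least-sierpiński f)
  ... | no  _ = 0

  ΓS : ℕ
  ΓS with function?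
  ... | yes f = proj₁ (greatest-sierpiński f)
  ... | no  _ = 0

  γS-isLeast : (V G → V H) → IsLeast (SierpińskiValue G H) γS
  γS-isLeast f with function?
  ... | yes f₀ = proj₂ (least-sierpiński f₀)
  ... | no ¬f  = contradiction f ¬f

  ΓS-isGreatest : (V G → V H) → IsGreatest (SierpińskiValue G H) ΓS
  ΓS-isGreatest f with function?
  ... | yes f₀ = proj₂ (greatest-sierpiński f₀)
  ... | no ¬f  = contradiction f ¬f

{-# OPTIONS --safe #-}
-- A dominating list of H, repeated over every vertex of G, dominates G ⊗[ f ] H;
-- this is the upper bound.  For the lower bound, let D be a minimum dominating list
-- of G ⊗[ f ] H, and for every edge of G add one end of the corresponding type 2
-- edge: an end outside D, unless both ends are in D.  Afterwards every copy of H is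
-- dominated from within itself, so D together with the m G added vertices contains
-- at least n G * γ H vertices.
module Submission where

open import Defs
open import Data.Integer.Base using (+_; _-_; -_; _⊖_; +≤+) renaming (_≤_ to _≤ℤ_)
import Data.Integer.Properties as ℤ
open import Data.Nat.Base using (_*_; _≤_; ℕ; _+_; _∸_; z≤n; s≤s)
open import Data.Nat.Properties
  using (≤-trans; ≤-reflexive; +-mono-≤; +-monoʳ-≤; +-suc; n≤1+n; m≤n+m; m+n∸n≡m;
         n≤0⇒n≡0; *-zeroʳ; module ≤-Reasoning)
open import Data.Product.Base using (_×_; ∃; _,_; proj₁; proj₂)
open import Data.Fin.Base using (Fin; zero; suc; _<_)
open import Data.Fin.Properties using (<-cmp) renaming (_≟_ to _≟ᶠ_)
open import Data.Fin.Subset using (Subset; _∪_; ⁅_⁆; ⋃; ∣_∣; inside; outside)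
  renaming (_∈_ to _∈ₛ_)
open import Data.Fin.Subset.Properties using (∣⊥∣≡0; ∣⁅x⁆∣≡1; x∈⁅x⁆; x∈p∪q⁺)
open import Data.List.Base
  using (List; []; _∷_; _++_; map; filter; length; allFin; cartesianProduct)
open import Data.List.Properties using (length-map; length-++; length-tabulate)
open import Data.List.Membership.Propositional using (_∈_)
open import Data.List.Membership.Propositional.Properties
  using (∈-map⁺; ∈-++⁺ˡ; ∈-++⁺ʳ; ∈-filter⁺; ∈-allFin; ∈-cartesianProduct⁺)
import Data.List.Membership.DecPropositional as DecMembership
open import Data.List.Relation.Unary.All as All using ([]; _∷_)
open import Data.List.Relation.Unary.AllPairs using ([]; _∷_)
open import Data.List.Relation.Unary.Any using (here; there)
open import Data.List.Relation.Unary.Unique.Propositional using (Unique)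
open import Data.List.Relation.Unary.Unique.Propositional.Properties using (allFin⁺)
open import Data.Sum.Base using (_⊎_; inj₁; inj₂)
import Data.Vec.Base as Vec
open import Function.Base using (_∘_; const)
open import Function.Bundles using (Inverse)
open import Level using (0ℓ)
open import Relation.Binary.Definitions using (DecidableEquality; tri<; tri≈; tri>)
open import Relation.Binary.PropositionalEquality
  using (_≡_; _≢_; refl; sym; trans; cong; cong₂; subst; subst₂)
open import Relation.Nullary.Decidable using (Dec; yes; no; ¬?)
open import Relation.Nullary.Negation using (¬_; contradiction)
open import Relation.Unary using (Pred; Decidable; _⊆_)

open Graph using (V; Adj)

private
  variable
    A B : Set

-- Lengths of products, filters and fibres of lists.

length-cartesianProduct : ∀ (xs : List A) (ys : List B) →
                          length (cartesianProduct xs ys) ≡ length xs * length ys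
length-cartesianProduct []       ys = refl
length-cartesianProduct (x ∷ xs) ys = trans (length-++ (map (x ,_) ys))
  (cong₂ _+_ (length-map (x ,_) ys) (length-cartesianProduct xs ys))

module _ {P : Pred A 0ℓ} (P? : Decidable P) where

  length-filter-∁ : ∀ xs → length (filter P? xs) + length (filter (¬? ∘ P?) xs) ≡ length xs
  length-filter-∁ []       = refl
  length-filter-∁ (x ∷ xs) with P? x
  ... | yes _ = cong ℕ.suc (length-filter-∁ xs)
  ... | no  _ = trans (+-suc _ _) (cong ℕ.suc (length-filter-∁ xs))

  -- Used to see that discarding one fibre leaves the other fibres intact.
  filter-filter-⊆ : ∀ {Q : Pred A 0ℓ} (Q? : Decidable Q) → Q ⊆ P →
                    ∀ xs → filter Q? (filter P? xs) ≡ filter Q? xs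
  filter-filter-⊆ Q? Q⊆P []       = refl
  -- When `P? x` is `yes`, the outer filter evaluates `Q? x` afresh, so `eq` is kept for the
  -- `rewrite`.
  filter-filter-⊆ Q? Q⊆P (x ∷ xs) with P? x | Q? x in eq
  ... | yes _ | yes _ rewrite eq = cong (x ∷_) (filter-filter-⊆ Q? Q⊆P xs)
  ... | yes _ | no  _ rewrite eq = filter-filter-⊆ Q? Q⊆P xs
  ... | no ¬p | yes q            = contradiction (Q⊆P q) ¬p
  ... | no  _ | no  _            = filter-filter-⊆ Q? Q⊆P xs

module _ (_≟ᴮ_ : DecidableEquality B) (p : A → B) where

  fibre : B → List A → List A
  fibre b = filter (λ x → p x ≟ᴮ b)

  -- Distinct fibres are disjoint pieces of `xs`. By induction on `bs`, the fibre over the head is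
  -- split off and the remaining elements still contain every other fibre in full.
  fibres-≤-length : ∀ {k bs} → Unique bs → ∀ xs →
                    (∀ {b} → b ∈ bs → k ≤ length (fibre b xs)) →
                    length bs * k ≤ length xs
  fibres-≤-length []                         xs k≤ = z≤n
  fibres-≤-length {k} {b ∷ bs} (b≢bs ∷ uniq) xs k≤ = begin
    k + length bs * k                   ≤⟨ +-mono-≤ (k≤ (here refl)) rest ⟩
    length (fibre b xs) + length others ≡⟨ length-filter-∁ (λ x → p x ≟ᴮ b) xs ⟩
    length xs                           ∎
    where
    open ≤-Reasoning
    others = filter (λ x → ¬? (p x ≟ᴮ b)) xs
    rest : length bs * k ≤ length others
    rest = fibres-≤-length uniq others λ {c} c∈bs →
      subst (λ ys → k ≤ length ys)
        (sym (filter-filter-⊆ (λ x → ¬? (p x ≟ᴮ b)) (λ x → p x ≟ᴮ c)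
          -- An element lying over both `c` and `b` would force `b ≡ c`, against `Unique`.
          (λ { refl px≡b → All.lookup b≢bs c∈bs (sym px≡b) }) xs))
        (k≤ (there c∈bs))

-- Passing between subsets and lists.

∣p∪q∣≤∣p∣+∣q∣ : ∀ {k} (p q : Subset k) → ∣ p ∪ q ∣ ≤ ∣ p ∣ + ∣ q ∣
∣p∪q∣≤∣p∣+∣q∣ Vec.[]            Vec.[]            = z≤n
∣p∪q∣≤∣p∣+∣q∣ (outside Vec.∷ p) (outside Vec.∷ q) = ∣p∪q∣≤∣p∣+∣q∣ p q
∣p∪q∣≤∣p∣+∣q∣ (outside Vec.∷ p) (inside  Vec.∷ q) =
  ≤-trans (s≤s (∣p∪q∣≤∣p∣+∣q∣ p q)) (≤-reflexive (sym (+-suc _ _)))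
∣p∪q∣≤∣p∣+∣q∣ (inside  Vec.∷ p) (outside Vec.∷ q) = s≤s (∣p∪q∣≤∣p∣+∣q∣ p q)
∣p∪q∣≤∣p∣+∣q∣ (inside  Vec.∷ p) (inside  Vec.∷ q) =
  s≤s (≤-trans (∣p∪q∣≤∣p∣+∣q∣ p q) (+-monoʳ-≤ ∣ p ∣ (n≤1+n _)))

fromList : ∀ {k} → List (Fin k) → Subset k
fromList = ⋃ ∘ map ⁅_⁆

-- Repetitions in the list collapse in the union, hence only an inequality.
∣fromList∣≤length : ∀ {k} (is : List (Fin k)) → ∣ fromList is ∣ ≤ length is
∣fromList∣≤length {k} []       = ≤-reflexive (∣⊥∣≡0 k)
∣fromList∣≤length     (i ∷ is) = ≤-trans (∣p∪q∣≤∣p∣+∣q∣ ⁅ i ⁆ (fromList is))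
  (+-mono-≤ (≤-reflexive (∣⁅x⁆∣≡1 i)) (∣fromList∣≤length is))

∈-fromList⁺ : ∀ {k} {i : Fin k} {is} → i ∈ is → i ∈ₛ fromList is
∈-fromList⁺ (here refl)  = x∈p∪q⁺ (inj₁ (x∈⁅x⁆ _))
∈-fromList⁺ (there i∈is) = x∈p∪q⁺ (inj₂ (∈-fromList⁺ i∈is))

toList : ∀ {k} → Subset k → List (Fin k)
toList Vec.[]            = []
toList (outside Vec.∷ p) = map suc (toList p)
toList (inside  Vec.∷ p) = zero ∷ map suc (toList p)

length-toList : ∀ {k} (p : Subset k) → length (toList p) ≡ ∣ p ∣
length-toList Vec.[]            = refl
length-toList (outside Vec.∷ p) = trans (length-map suc (toList p)) (length-toList p)
length-toList (inside  Vec.∷ p) =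
  cong ℕ.suc (trans (length-map suc (toList p)) (length-toList p))

∈-toList⁺ : ∀ {k} {i : Fin k} {p} → i ∈ₛ p → i ∈ toList p
∈-toList⁺                           Vec.here        = here refl
∈-toList⁺ {p = outside Vec.∷ _} (Vec.there i∈p) = ∈-map⁺ suc (∈-toList⁺ i∈p)
∈-toList⁺ {p = inside  Vec.∷ _} (Vec.there i∈p) = there (∈-map⁺ suc (∈-toList⁺ i∈p))

-- Lists may repeat vertices, so they can be concatenated and projected without disjointness or
-- injectivity arguments; repetition can only increase the length, which is harmless for upper
-- bounds on `γ`.
DominatingList : (X : Graph) → List (V X) → Set
DominatingList X L = ∀ v → v ∈ L ⊎ (∃ λ u → u ∈ L × Adj X v u)

γ≤length : ∀ X L → DominatingList X L → γ X ≤ length L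
γ≤length X L dom = ≤-trans
  (proj₂ (proj₂ (least-dominating X)) _ (S , dominating , refl))
  (≤-trans (∣fromList∣≤length (map index L)) (≤-reflexive (length-map index L)))
  where
  open Graph X using (index)
  S = fromList (map index L)
  index∈S : ∀ {u} → u ∈ L → index u ∈ₛ S
  index∈S = ∈-fromList⁺ ∘ ∈-map⁺ index
  dominating : Dominating X S
  dominating v with dom v
  ... | inj₁ v∈L             = inj₁ (index∈S v∈L)
  ... | inj₂ (u , u∈L , adj) = inj₂ (u , index∈S u∈L , adj)

minimumDominatingList : ∀ X → ∃ λ L → DominatingList X L × length L ≡ γ X
minimumDominatingList X with least-dominating X
... | _ , (S , dom , refl) , _ = L , dominating ,
  trans (length-map vertex (toList S)) (length-toList S)
  where
  open Graph X using (index; vertex; vertex-index)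
  L = map vertex (toList S)
  ∈L : ∀ {u} → index u ∈ₛ S → u ∈ L
  ∈L {u} i∈S = subst (_∈ L) (vertex-index u) (∈-map⁺ vertex (∈-toList⁺ i∈S))
  dominating : DominatingList X L
  dominating v with dom v
  ... | inj₁ v∈S             = inj₁ (∈L v∈S)
  ... | inj₂ (u , u∈S , adj) = inj₂ (u , ∈L u∈S , adj)

-- Vertices and edges of a graph as lists.

module _ (X : Graph) where
  open Graph X using (index; vertex; vertex-index; adj-irrefl)

  vertices : List (V X)
  vertices = map vertex (allFin (n X))

  ∈-vertices : ∀ v → v ∈ vertices
  ∈-vertices v = subst (_∈ vertices) (vertex-index v) (∈-map⁺ vertex (∈-allFin (index v)))

  length-vertices : length vertices ≡ n X
  length-vertices = trans (length-map vertex (allFin (n X))) (length-tabulate {n = n X} _)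

  Adj⇒∈edges : ∀ {u v} → Adj X u v → index u < index v → (index u , index v) ∈ edges X
  Adj⇒∈edges {u} {v} adj u<v = ∈-filter⁺ _
    (∈-cartesianProduct⁺ (∈-allFin (index u)) (∈-allFin (index v)))
    (u<v , subst₂ (Adj X) (sym (vertex-index u)) (sym (vertex-index v)) adj)

  Adj⇒index≢ : ∀ {u v} → Adj X u v → index u ≢ index v
  Adj⇒index≢ {u} {v} adj eq = adj-irrefl
    (trans (sym (vertex-index u)) (trans (cong vertex eq) (vertex-index v))) adj

-- The two bounds for a fixed `f`.

module _ (G H : Graph) (f : V G → V H) where
  private
    module G = Graph G

    X : Graph
    X = G ⊗[ f ] H

  γ-Sierpiński≤ : γ X ≤ n G * γ H
  γ-Sierpiński≤ with minimumDominatingList H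
  ... | L , dom , size = begin
    γ X                                      ≤⟨ γ≤length X _ dominating ⟩
    length (cartesianProduct (vertices G) L) ≡⟨ length-cartesianProduct (vertices G) L ⟩
    length (vertices G) * length L           ≡⟨ cong₂ _*_ (length-vertices G) size ⟩
    n G * γ H                                ∎
    where
    open ≤-Reasoning
    dominating : DominatingList X (cartesianProduct (vertices G) L)
    dominating (g , h) with dom h
    ... | inj₁ h∈L             = inj₁ (∈-cartesianProduct⁺ (∈-vertices G g) h∈L)
    -- Type 1 edges suffice here, so the bound holds for every `f`.
    ... | inj₂ (u , u∈L , adj) =
      inj₂ ((g , u) , ∈-cartesianProduct⁺ (∈-vertices G g) u∈L , inj₁ (refl , adj))

  -- The trace of a list on the copy of `H` at `g`. First coordinates are compared by index because
  -- the fibres are later counted over `allFin (n G)`.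
  layer : V G → List (V X) → List (V H)
  layer g = map proj₂ ∘ fibre _≟ᶠ_ (G.index ∘ proj₁) (G.index g)

  ∈-layer⁺ : ∀ {g h L} → (g , h) ∈ L → h ∈ layer g L
  ∈-layer⁺ gh∈L = ∈-map⁺ proj₂ (∈-filter⁺ _ gh∈L refl)

  -- The layers come from disjoint fibres of `L`, one for each vertex of `G`, and each has length at
  -- least `γ H`.
  layers-dominating⇒≤length : ∀ L → (∀ g → DominatingList H (layer g L)) → n G * γ H ≤ length L
  layers-dominating⇒≤length L dom = subst (λ k → k * γ H ≤ length L) (length-tabulate {n = n G} _)
    (fibres-≤-length _≟ᶠ_ (G.index ∘ proj₁) (allFin⁺ (n G)) L λ {i} _ → γ≤fibre i)
    where
    p : V X → Fin (n G)
    p = G.index ∘ proj₁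
    γ≤fibre : ∀ i → γ H ≤ length (fibre _≟ᶠ_ p i L)
    -- `dom` speaks of vertices and the count of indices, so `i` is first written as the index of
    -- `G.vertex i`.
    γ≤fibre i = subst (λ j → γ H ≤ length (fibre _≟ᶠ_ p j L)) (Inverse.strictlyInverseˡ G.finite i)
      (≤-trans (γ≤length H _ (dom (G.vertex i)))
        (≤-reflexive (length-map proj₂ (fibre _≟ᶠ_ p (G.index (G.vertex i)) L))))

  module _ (D : List (V X)) where
    open DecMembership (Graph._≟ᵛ_ X) using (_∈?_)

    -- Testing one end is enough: whenever exactly one end of the type 2 edge lies in `D`, the other
    -- end is returned.
    addedEnd : V G → V G → V X
    addedEnd g g′ with (g , f g′) ∈? D
    ... | yes _ = g′ , f g
    ... | no  _ = g , f g′

    addedEnds : List (V X)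
    addedEnds = map (λ (i , j) → addedEnd (G.vertex i) (G.vertex j)) (edges G)

    addedEnd∈addedEnds : ∀ {g g′} → G.Adj g g′ → G.index g < G.index g′ → addedEnd g g′ ∈ addedEnds
    addedEnd∈addedEnds adj g<g′ = subst (_∈ addedEnds)
      (cong₂ addedEnd (G.vertex-index _) (G.vertex-index _))
      (∈-map⁺ _ (Adj⇒∈edges G adj g<g′))

    -- The edge is listed in one orientation only, so the end tested by `addedEnd` depends on which
    -- index is smaller.
    end-covered : ∀ {g g′} → G.Adj g g′ → (g′ , f g) ∈ D → (g , f g′) ∈ D ++ addedEnds
    end-covered {g} {g′} adj g′∈D with <-cmp (G.index g) (G.index g′)
    ... | tri≈ _ g≡g′ _ = contradiction g≡g′ (Adj⇒index≢ G adj)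
    -- The tested end is the wanted one: it is in `D`, or else it is added.
    ... | tri< g<g′ _ _ with (g , f g′) ∈? D | addedEnd∈addedEnds adj g<g′
    ...   | yes g∈D | _     = ∈-++⁺ˡ g∈D
    ...   | no  _   | added = ∈-++⁺ʳ D added
    -- The tested end is now `(g′ , f g)`, which is in `D`, so the wanted end is the one added.
    end-covered {g} {g′} adj g′∈D | tri> _ _ g′<g
      with (g′ , f g) ∈? D | addedEnd∈addedEnds (G.adj-sym adj) g′<g
    ...   | yes _    | added = ∈-++⁺ʳ D added
    ...   | no  g′∉D | _     = contradiction g′∈D g′∉D

    layer-dominating : DominatingList X D → ∀ g → DominatingList H (layer g (D ++ addedEnds))
    layer-dominating dom g h with dom (g , h)
    ... | inj₁ gh∈D = inj₁ (∈-layer⁺ (∈-++⁺ˡ gh∈D))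
    ... | inj₂ ((_ , h′) , u∈D , inj₁ (refl , adj)) = inj₂ (h′ , ∈-layer⁺ (∈-++⁺ˡ u∈D) , adj)
    -- Domination from another copy of `H` uses a type 2 edge; its end in this copy belongs to the
    -- enlarged list.
    ... | inj₂ ((g′ , _) , u∈D , inj₂ (adj , refl , refl)) = inj₁ (∈-layer⁺ (end-covered adj u∈D))

  n*γ≤γ-Sierpiński+m : n G * γ H ≤ γ X + m G
  n*γ≤γ-Sierpiński+m with minimumDominatingList X
  ... | D , dom , size = begin
    n G * γ H                       ≤⟨ layers-dominating⇒≤length (D ++ addedEnds D)
                                          (layer-dominating D dom) ⟩
    length (D ++ addedEnds D)       ≡⟨ length-++ D ⟩
    length D + length (addedEnds D) ≡⟨ cong₂ _+_ size (length-map _ (edges G)) ⟩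
    γ X + m G                       ∎
    where open ≤-Reasoning

-- The degenerate case without functions from `V G` to `V H`.

module _ (G H : Graph) where

  γS-empty : ¬ (V G → V H) → γS G H ≡ 0
  γS-empty ¬f with function? G H
  ... | yes f = contradiction f ¬f
  ... | no  _ = refl

  ΓS-empty : ¬ (V G → V H) → ΓS G H ≡ 0
  ΓS-empty ¬f with function? G H
  ... | yes f = contradiction f ¬f
  ... | no  _ = refl

  -- Any vertex of `H` would give a constant function, so `H` is empty and the empty list dominates
  -- it.
  γ-empty : ¬ (V G → V H) → γ H ≡ 0
  γ-empty ¬f = n≤0⇒n≡0 (γ≤length H [] λ h → contradiction (const h) ¬f)

-- The counting argument gives a subtraction-free inequality in ℕ, while the theorem subtracts in ℤ,
-- where the lower bound may be negative.
a≤b+c⇒a-c≤b : ∀ a b c → a ≤ b + c → + a - + c ≤ℤ + b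
a≤b+c⇒a-c≤b a b c a≤b+c = begin
  + a - + c       ≤⟨ ℤ.+-monoˡ-≤ (- + c) (+≤+ a≤b+c) ⟩
  + (b + c) - + c ≡⟨ ℤ.[+m]-[+n]≡m⊖n (b + c) c ⟩
  (b + c) ⊖ c     ≡⟨ ℤ.⊖-≥ (m≤n+m c b) ⟩
  + (b + c ∸ c)   ≡⟨ cong +_ (m+n∸n≡m b c) ⟩
  + b             ∎
  where open ℤ.≤-Reasoning

theorem2p1 : (G H : Graph) →
    (+ (n G * γ H) - + m G ≤ℤ + γS G H) × (γS G H ≤ ΓS G H) × (ΓS G H ≤ n G * γ H)
theorem2p1 G H = bounds (function? G H)
  where
  bounds : Dec (V G → V H) →
    (+ (n G * γ H) - + m G ≤ℤ + γS G H) × (γS G H ≤ ΓS G H) × (ΓS G H ≤ n G * γ H)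
  bounds (yes f) with γS-isLeast G H f | ΓS-isGreatest G H f
  ... | (f₁ , γX₁≡γS) , γS≤ | (f₂ , γX₂≡ΓS) , _ =
      a≤b+c⇒a-c≤b (n G * γ H) (γS G H) (m G)
        (subst (λ k → n G * γ H ≤ k + m G) γX₁≡γS (n*γ≤γ-Sierpiński+m G H f₁))
    -- The maximum is itself attained, so the minimum is at most it.
    , γS≤ _ (f₂ , γX₂≡ΓS)
    , subst (_≤ n G * γ H) γX₂≡ΓS (γ-Sierpiński≤ G H f₂)
  -- Both extrema default to 0 and `γ H` is 0, so the lower bound reads `0 - m G ≤ 0`.
  bounds (no ¬f) rewrite γS-empty G H ¬f | ΓS-empty G H ¬f | γ-empty G H ¬f | *-zeroʳ (n G) =
    a≤b+c⇒a-c≤b 0 0 (m G) z≤n , z≤n , z≤n
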